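{- Let $L$ be a bounded lattice, $k\in\mathbb{N}^*$, and $\otimes$ a t-norm on $L$ that is both $\wedge$-distributive and $\vee$-distributive and such that $\langle L,\otimes\rangle$ is divisible. A function $F:L^2\to L$ is $\otimes^k$-homogeneous, has $1_L$ as neutral element, and satisfies $F(x,y)=F(x\wedge y,x\vee y)$ for all $x,y\in L$ if and only if $$F(x,y)=(x\wedge y)\otimes(x\vee y)_\otimes^{(k-1)}\quad\text{for all }x,y\in L.$$
   Context: A t-norm on $L$ is a commutative, associative map $L^2\to L$, non-decreasing in each argument, with neutral element $1_L$. It is $\wedge$-distributive if $x\otimes(y\wedge z)=(x\otimes y)\wedge(x\otimes z)$ and $\vee$-distributive if $x\otimes(y\vee z)=(x\otimes y)\vee(x\otimes z)$, for all $x,y,z$. $\langle L,\otimes\rangle$ is divisible if for all $x,y$ with $y\le_Lx$ there is $z$ with $y=x\otimes z$. Powers: $\lambda_\otimes^{(0)}=1_L$, $\lambda_\otimes^{(1)}=\lambda$, $\lambda_\otimes^{(m)}=\lambda\otimes\lambda_\otimes^{(m-1)}$ for $m\ge2$. $F:L^2\to L$ is $\otimes^k$-homogeneous if $F(\lambda\otimes x,\lambda\otimes y)=\lambda_\otimes^{(k)}\otimes F(x,y)$ for all $\lambda,x,y\in L$. $1_L$ is a neutral element of $F$ if $F(x,1_L)=F(1_L,x)=x$ for all $x$. -}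

module Defs where

open import Algebra.Core using (Op₂)
open import Data.Nat.Base using (ℕ; zero; suc)
open import Data.Product.Base using (∃-syntax)
open import Level using (_⊔_)
open import Relation.Binary.Definitions using (LeftMonotonic; RightMonotonic)
open import Relation.Binary.Lattice.Bundles using (BoundedLattice)
import Algebra.Definitions

module _ {c ℓ₁ ℓ₂} (L : BoundedLattice c ℓ₁ ℓ₂) where

  open BoundedLattice L
  open Algebra.Definitions _≈_ using (Associative; Commutative; Identity)

  -- Congruence of _⊗_ with respect to _≈_ is not a field: it follows from
  -- monotonicity in each argument and antisymmetry of _≤_.
  record IsTNorm (_⊗_ : Op₂ Carrier) : Set (c ⊔ ℓ₁ ⊔ ℓ₂) where
    field
      comm     : Commutative _⊗_
      assoc    : Associative _⊗_
      monoˡ    : LeftMonotonic _≤_ _≤_ _⊗_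
      monoʳ    : RightMonotonic _≤_ _≤_ _⊗_
      identity : Identity ⊤ _⊗_

  Divisible : Op₂ Carrier → Set (c ⊔ ℓ₁ ⊔ ℓ₂)
  Divisible _⊗_ = ∀ x y → y ≤ x → ∃[ z ] y ≈ (x ⊗ z)

  power : Op₂ Carrier → Carrier → ℕ → Carrier
  power _⊗_ x zero          = ⊤
  power _⊗_ x (suc zero)    = x
  power _⊗_ x (suc (suc m)) = x ⊗ power _⊗_ x (suc m)

  Homogeneous : Op₂ Carrier → ℕ → Op₂ Carrier → Set (c ⊔ ℓ₁)
  Homogeneous _⊗_ k F =
    ∀ a x y → F (a ⊗ x) (a ⊗ y) ≈ (power _⊗_ a k ⊗ F x y)

-- Divisibility gives x ∧ y ≈ (x ∨ y) ⊗ z for some z, so homogeneity with scale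
-- x ∨ y reduces F (x ∧ y) (x ∨ y) to F z ⊤ ≈ z. Conversely, distributivity lets
-- a scale pass through the meet and the join in the closed formula.
module Submission where

open import Defs
open import Algebra.Bundles using (CommutativeMonoid)
open import Algebra.Core using (Op₂)
open import Algebra.Definitions using (Congruent₂; Identity; _DistributesOverˡ_)
import Algebra.Properties.CommutativeMonoid.Mult as CommutativeMonoidMult
import Algebra.Properties.CommutativeSemigroup as CommutativeSemigroupProperties
open import Data.Nat.Base using (ℕ; zero; suc; NonZero; pred)
open import Data.Product.Base using (_×_; _,_; proj₁; proj₂)
open import Function.Bundles using (_⇔_; mk⇔)
open import Relation.Binary.Consequences using (mono₂⇒cong₂)
open import Relation.Binary.Lattice.Bundles using (BoundedLattice)
import Relation.Binary.Lattice.Properties.BoundedJoinSemilattice as BoundedJoin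
import Relation.Binary.Lattice.Properties.BoundedLattice as Bounded
import Relation.Binary.Lattice.Properties.BoundedMeetSemilattice as BoundedMeet
import Relation.Binary.Lattice.Properties.JoinSemilattice as Join
import Relation.Binary.Lattice.Properties.Lattice as LatticeProperties
import Relation.Binary.Lattice.Properties.MeetSemilattice as Meet
import Relation.Binary.Reasoning.Setoid as SetoidReasoning

module TNorm {c ℓ₁ ℓ₂} (L : BoundedLattice c ℓ₁ ℓ₂)
             (_⊗_ : Op₂ (BoundedLattice.Carrier L)) (isTNorm : IsTNorm L _⊗_) where

  open BoundedLattice L
  open IsTNorm isTNorm
  open SetoidReasoning setoid
  open BoundedMeet boundedMeetSemilattice using ()
    renaming (identityˡ to ∧-identityˡ; identityʳ to ∧-identityʳ)
  open Bounded L using (∨-zeroˡ; ∨-zeroʳ)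
  open Join joinSemilattice using (x≤y⇒x∨y≈y)
  open Meet meetSemilattice using (∧-comm; y≤x⇒x∧y≈y)
  open LatticeProperties lattice using (∧≤∨)

  ⊗-cong : Congruent₂ _≈_ _⊗_
  ⊗-cong = mono₂⇒cong₂ _≈_ _≈_ Eq.sym reflexive antisym
    λ {x} {y} {u} {v} x≤y u≤v → trans (monoʳ u x≤y) (monoˡ y u≤v)

  commutativeMonoid : CommutativeMonoid c ℓ₁
  commutativeMonoid = record
    { isCommutativeMonoid = record
      { isMonoid = record
        { isSemigroup = record
          { isMagma = record { isEquivalence = isEquivalence ; ∙-cong = ⊗-cong }
          ; assoc   = assoc
          }
        ; identity = identity
        }
      ; comm = comm
      }
    }

  open CommutativeMonoid commutativeMonoid using (commutativeSemigroup)
    renaming (∙-congˡ to ⊗-congˡ; ∙-congʳ to ⊗-congʳ; identityʳ to ⊗-identityʳ)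
  open CommutativeSemigroupProperties commutativeSemigroup using (interchange; xy∙z≈xz∙y)
  open CommutativeMonoidMult commutativeMonoid using (×-congʳ; ×-distrib-+; ×-idem)
    renaming (_×_ to _×ᵐ_)

  infixl 8 _^_
  _^_ : Carrier → ℕ → Carrier
  _^_ = power L _⊗_

  -- `power` has its own clause for exponent one, without a trailing `⊤`, so the uniform recursion
  -- costs a unit law at `zero`.
  ^-suc : ∀ x n → x ^ suc n ≈ (x ⊗ (x ^ n))
  ^-suc x zero    = Eq.sym (⊗-identityʳ x)
  ^-suc x (suc n) = Eq.refl

  -- Identifies powers with iterated multiples in the monoid of `⊗` and `⊤`, whose known laws then
  -- carry over.
  ^≈× : ∀ x n → x ^ n ≈ n ×ᵐ x
  ^≈× x zero    = Eq.refl
  ^≈× x (suc n) = Eq.trans (^-suc x n) (⊗-congˡ (^≈× x n))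

  ^-congˡ : ∀ n {x y} → x ≈ y → x ^ n ≈ y ^ n
  ^-congˡ n {x} {y} x≈y = begin
    x ^ n   ≈⟨ ^≈× x n ⟩
    n ×ᵐ x  ≈⟨ ×-congʳ n x≈y ⟩
    n ×ᵐ y  ≈⟨ ^≈× y n ⟨
    y ^ n   ∎

  ^-distrib-⊗ : ∀ x y n → (x ⊗ y) ^ n ≈ ((x ^ n) ⊗ (y ^ n))
  ^-distrib-⊗ x y n = begin
    (x ⊗ y) ^ n            ≈⟨ ^≈× (x ⊗ y) n ⟩
    n ×ᵐ (x ⊗ y)           ≈⟨ ×-distrib-+ x y n ⟩
    ((n ×ᵐ x) ⊗ (n ×ᵐ y))  ≈⟨ ⊗-cong (^≈× x n) (^≈× y n) ⟨
    ((x ^ n) ⊗ (y ^ n))    ∎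

  ⊤^n≈⊤ : ∀ n → ⊤ ^ n ≈ ⊤
  ⊤^n≈⊤ zero      = Eq.refl
  -- `×-idem` asks for a nonzero multiplier, hence the case split.
  ⊤^n≈⊤ n@(suc _) = Eq.trans (^≈× ⊤ n) (×-idem (⊗-identityʳ ⊤) n)

  -- The closed formula of the theorem, indexed by k - 1 to avoid subtraction.
  ∧⊗∨^ : ℕ → Op₂ Carrier
  ∧⊗∨^ n x y = (x ∧ y) ⊗ ((x ∨ y) ^ n)

  ∧⊗∨^-cong : ∀ n {x y u v} → x ∧ y ≈ u ∧ v → x ∨ y ≈ u ∨ v → ∧⊗∨^ n x y ≈ ∧⊗∨^ n u v
  ∧⊗∨^-cong n meets joins = ⊗-cong meets (^-congˡ n joins)

  -- The degree is a count of factors `a`: one comes out of the meet and `n` out of the power of the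
  -- join.
  ∧⊗∨^-homogeneous : _DistributesOverˡ_ _≈_ _⊗_ _∧_ → _DistributesOverˡ_ _≈_ _⊗_ _∨_ →
                     ∀ n → Homogeneous L _⊗_ (suc n) (∧⊗∨^ n)
  ∧⊗∨^-homogeneous ⊗-distrib-∧ ⊗-distrib-∨ n a x y = begin
    ((a ⊗ x) ∧ (a ⊗ y)) ⊗ (((a ⊗ x) ∨ (a ⊗ y)) ^ n)
      ≈⟨ ⊗-cong (⊗-distrib-∧ a x y) (^-congˡ n (⊗-distrib-∨ a x y)) ⟨
    (a ⊗ (x ∧ y)) ⊗ ((a ⊗ (x ∨ y)) ^ n)
      ≈⟨ ⊗-congˡ (^-distrib-⊗ a (x ∨ y) n) ⟩
    (a ⊗ (x ∧ y)) ⊗ ((a ^ n) ⊗ ((x ∨ y) ^ n))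
      ≈⟨ interchange a (x ∧ y) (a ^ n) ((x ∨ y) ^ n) ⟩
    (a ⊗ (a ^ n)) ⊗ ((x ∧ y) ⊗ ((x ∨ y) ^ n))
      ≈⟨ ⊗-congʳ (^-suc a n) ⟨
    (a ^ suc n) ⊗ ((x ∧ y) ⊗ ((x ∨ y) ^ n)) ∎

  -- Against `⊤` the join is `⊤`, so its power disappears, and the meet is the other argument.
  ∧⊗∨^-identity : ∀ n → Identity _≈_ ⊤ (∧⊗∨^ n)
  ∧⊗∨^-identity n =
      (λ x → absorb (∧-identityˡ x) (∨-zeroˡ x))
    , (λ x → absorb (∧-identityʳ x) (∨-zeroʳ x))
    where
    absorb : ∀ {x m j} → m ≈ x → j ≈ ⊤ → (m ⊗ (j ^ n)) ≈ x
    absorb {x} {m} {j} m≈x j≈⊤ = begin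
      m ⊗ (j ^ n)  ≈⟨ ⊗-cong m≈x (^-congˡ n j≈⊤) ⟩
      x ⊗ (⊤ ^ n)  ≈⟨ ⊗-congˡ (⊤^n≈⊤ n) ⟩
      x ⊗ ⊤        ≈⟨ ⊗-identityʳ x ⟩
      x            ∎

  -- The formula sees its arguments only through their meet and join, and since `x ∧ y ≤ x ∨ y`
  -- these do not change.
  ∧⊗∨^-∧-∨ : ∀ n x y → ∧⊗∨^ n x y ≈ ∧⊗∨^ n (x ∧ y) (x ∨ y)
  ∧⊗∨^-∧-∨ n x y = ∧⊗∨^-cong n
    (Eq.sym (Eq.trans (∧-comm _ _) (y≤x⇒x∧y≈y ∧≤∨)))
    (Eq.sym (x≤y⇒x∨y≈y ∧≤∨))

  module _ {F : Op₂ Carrier} (F-cong : Congruent₂ _≈_ F) where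

    homogeneous-on-≤ : Divisible L _⊗_ → ∀ n → Homogeneous L _⊗_ (suc n) F →
                       Identity _≈_ ⊤ F → ∀ {x y} → x ≤ y → F x y ≈ (x ⊗ (y ^ n))
    homogeneous-on-≤ divisible n homogeneous F-identity {x} {y} x≤y
      with z , x≈y⊗z ← divisible y x x≤y = begin
        -- The second argument becomes `y ⊗ ⊤`, so that `y` is a common scale and the neutral
        -- element remains.
        F x y                ≈⟨ F-cong x≈y⊗z (Eq.sym (⊗-identityʳ y)) ⟩
        F (y ⊗ z) (y ⊗ ⊤)    ≈⟨ homogeneous y z ⊤ ⟩
        (y ^ suc n) ⊗ F z ⊤  ≈⟨ ⊗-cong (^-suc y n) (proj₂ F-identity z) ⟩
        -- Of the `suc n` factors `y`, one is paired with `z` to restore `x`; this is why the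
        -- exponent drops to `n`.
        (y ⊗ (y ^ n)) ⊗ z    ≈⟨ xy∙z≈xz∙y y (y ^ n) z ⟩
        (y ⊗ z) ⊗ (y ^ n)    ≈⟨ ⊗-congʳ x≈y⊗z ⟨
        x ⊗ (y ^ n)          ∎

    characterization :
      _DistributesOverˡ_ _≈_ _⊗_ _∧_ → _DistributesOverˡ_ _≈_ _⊗_ _∨_ →
      Divisible L _⊗_ → ∀ n →
      (Homogeneous L _⊗_ (suc n) F × Identity _≈_ ⊤ F ×
       (∀ x y → F x y ≈ F (x ∧ y) (x ∨ y)))
      ⇔ (∀ x y → F x y ≈ ∧⊗∨^ n x y)
    characterization ⊗-distrib-∧ ⊗-distrib-∨ divisible n = mk⇔
      (λ (homogeneous , F-identity , F-∧-∨) x y →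
        -- Passing to meet and join makes any pair comparable, as divisibility requires.
        Eq.trans (F-∧-∨ x y) (homogeneous-on-≤ divisible n homogeneous F-identity ∧≤∨))
      -- Each property of the closed formula is carried over to `F` along `F≈`.
      (λ F≈ →
          (λ a x y → Eq.trans (F≈ _ _)
            (Eq.trans (∧⊗∨^-homogeneous ⊗-distrib-∧ ⊗-distrib-∨ n a x y)
                      (⊗-congˡ (Eq.sym (F≈ x y)))))
        , ( (λ x → Eq.trans (F≈ ⊤ x) (proj₁ (∧⊗∨^-identity n) x))
          , (λ x → Eq.trans (F≈ x ⊤) (proj₂ (∧⊗∨^-identity n) x)))
        , (λ x y → Eq.trans (F≈ x y) (Eq.trans (∧⊗∨^-∧-∨ n x y) (Eq.sym (F≈ _ _)))))

mainTheorem12 : ∀ {c ℓ₁ ℓ₂} (L : BoundedLattice c ℓ₁ ℓ₂) →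
    let open BoundedLattice L in
    (k : ℕ) .{{_ : NonZero k}} →
    (_⊗_ : Op₂ Carrier) →
    IsTNorm L _⊗_ →
    (_DistributesOverˡ_ _≈_ _⊗_ _∧_) →
    (_DistributesOverˡ_ _≈_ _⊗_ _∨_) →
    Divisible L _⊗_ →
    (F : Op₂ Carrier) → Congruent₂ _≈_ F →
    (Homogeneous L _⊗_ k F ×
    Identity _≈_ ⊤ F ×
    (∀ x y → F x y ≈ F (x ∧ y) (x ∨ y)))
    ⇔
    (∀ x y → F x y ≈ ((x ∧ y) ⊗ power L _⊗_ (x ∨ y) (pred k)))
-- Since `k` is nonzero only `suc n` occurs, and `pred k` computes to `n`.
mainTheorem12 L (suc n) _⊗_ isTNorm ⊗-distrib-∧ ⊗-distrib-∨ divisible F F-cong =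
  TNorm.characterization L _⊗_ isTNorm F-cong ⊗-distrib-∧ ⊗-distrib-∨ divisible n
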